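{- Let $t, r, n, k$ be integers with $1 \leq t \leq r$, $n \geq n_{\rm S}(r,t)$ and $k \geq 2$. For all $i \in [k]$, let $\emptyset \neq S_i \subseteq [t,r]$ and $\mathcal{F}_i := \bigcup_{s \in S_i}\binom{[n]}{s}$. Let $\mathcal{A}_1, \dots, \mathcal{A}_k$ be cross-$t$-intersecting families such that $\mathcal{A}_i \subseteq \mathcal{F}_i$ for all $i \in [k]$. Then \[ \sum_{i = 1}^k |\mathcal{A}_i| \leq \max \left\{ \sum_{i = 1}^k \sum_{s \in S_i}\binom{n-t}{s-t}, \sum_{s \in S_1}\binom{n}{s}, \dots, \sum_{s \in S_k}\binom{n}{s} \right\}.\] Moreover, equality holds if and only if one of the following holds: (i) $\sum_{i = 1}^k \sum_{s \in S_i}\binom{n-t}{s-t} > \max\{\sum_{s \in S_i}\binom{n}{s} : i \in [k]\}$ and, for some $t$-subset $T$ of $[n]$, $\mathcal{A}_i = \mathcal{F}_i \langle T \rangle$ for all $i \in [k]$; (ii) $\sum_{i = 1}^k \sum_{s \in S_i}\binom{n-t}{s-t} < \max\{\sum_{s \in S_i}\binom{n}{s} : i \in [k]\}$ and, for some $j \in [k]$ such that $|\mathcal{F}_j| = \max\{|\mathcal{F}_i| : i \in [k]\}$, $\mathcal{A}_j = \mathcal{F}_j$ and $\mathcal{A}_i = \emptyset$ for all $i \in [k] \setminus \{j\}$; (iii) $\sum_{i = 1}^k \sum_{s \in S_i}\binom{n-t}{s-t} = \max\{\sum_{s \in S_i}\binom{n}{s} : i \in [k]\}$, and $\mathcal{A}_1,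 \dots, \mathcal{A}_k$ are as in (i) or (ii).
   Context: For integers $m \le n$, $[m,n] := \{i \in \{1,2,\dots\} : m \le i \le n\}$ and $[n] := [1,n]$. For a set $X$, $\binom{X}{s}$ is the family of $s$-subsets of $X$. For a family $\mathcal{F}$ and a set $T$, $\mathcal{F}\langle T\rangle := \{F \in \mathcal{F} : T \subseteq F\}$. A set $A$ $t$-intersects $B$ if $|A\cap B| \ge t$. Families $\mathcal{A}_1,\dots,\mathcal{A}_k$ are cross-$t$-intersecting if for all distinct $i,j \in [k]$, every set in $\mathcal{A}_i$ $t$-intersects every set in $\mathcal{A}_j$. Define $m(r,t) := \max\{2r, \frac{(r-t)(r-t+5)}{2} + (t-1)\}$ and $n_{\rm S}(r,t) := (r-t+1)\binom{m(r,t)}{t+1} + r$. -}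

module Defs where

open import Data.Bool using (Bool; true; false; _∧_; if_then_else_)
open import Data.Nat using (ℕ; zero; suc; _+_; _*_; _∸_; _⊔_; _/_; _≤_)
open import Data.Nat.Combinatorics using (_C_)
open import Data.Fin using (Fin)
open import Data.Fin.Subset using (Subset; _∩_; ∣_∣; _⊆_; inside; outside)
open import Data.Fin.Subset.Properties using (_⊆?_)
open import Data.Vec using (_∷_; [])
open import Data.List using (List; []; _∷_; _++_; map; allFin; upTo; filterᵇ; length)
open import Data.Nat.ListAction using (sum)
open import Data.Product using (Σ; _×_)
open import Relation.Nullary.Decidable using (⌊_⌋)
open import Relation.Binary.PropositionalEquality using (_≡_; _≢_)

-- m(r,t) = max{2r, (r-t)(r-t+5)/2 + (t-1)}   ((r-t)(r-t+5) is always even)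
mRT : ℕ → ℕ → ℕ
mRT r t = (2 * r) ⊔ (((r ∸ t) * (r ∸ t + 5)) / 2 + (t ∸ 1))

nS : ℕ → ℕ → ℕ
nS r t = (r ∸ t + 1) * (mRT r t C (t + 1)) + r

allSubsets : (n : ℕ) → List (Subset n)
allSubsets zero = [] ∷ []
allSubsets (suc n) = map (outside ∷_) (allSubsets n) ++ map (inside ∷_) (allSubsets n)

Family : ℕ → Set
Family n = Subset n → Bool

card : {n : ℕ} → Family n → ℕ
card {n} A = length (filterᵇ A (allSubsets n))

NatSet : Set
NatSet = ℕ → Bool

SubsetOfRange : ℕ → ℕ → NatSet → Set
SubsetOfRange t r S = ∀ s → S s ≡ true → t ≤ s × s ≤ r

NonEmptyNatSet : NatSet → Set
NonEmptyNatSet S = Σ ℕ (λ s → S s ≡ true)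

-- Σ_{s ∈ S} f s, for S ⊆ [0, r]
sumOver : ℕ → NatSet → (ℕ → ℕ) → ℕ
sumOver r S f = sum (map (λ s → if S s then f s else 0) (upTo (suc r)))

-- ℱ = ⋃_{s ∈ S} ([n] choose s)
layers : (n : ℕ) → NatSet → Family n
layers n S X = S ∣ X ∣

contain : {n : ℕ} → Family n → Subset n → Family n
contain F T X = F X ∧ ⌊ T ⊆? X ⌋

sumFin : (k : ℕ) → (Fin k → ℕ) → ℕ
sumFin k f = sum (map f (allFin k))

maxFin : (k : ℕ) → (Fin k → ℕ) → ℕ
maxFin k f = Data.List.foldr _⊔_ 0 (map f (allFin k))
  where import Data.List

TIntersects : {n : ℕ} → ℕ → Subset n → Subset n → Set
TIntersects t A B = t ≤ ∣ A ∩ B ∣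

CrossTIntersecting : {n k : ℕ} → ℕ → (Fin k → Family n) → Set
CrossTIntersecting {n} t A = ∀ i j → i ≢ j → (X Y : Subset n) →
  A i X ≡ true → A j Y ≡ true → TIntersects t X Y

FamSubset : {n : ℕ} → Family n → Family n → Set
FamSubset {n} A F = (X : Subset n) → A X ≡ true → F X ≡ true

FamEq : {n : ℕ} → Family n → Family n → Set
FamEq {n} A F = (X : Subset n) → A X ≡ F X

emptyFam : {n : ℕ} → Family n
emptyFam _ = false

ConfigI : {n k : ℕ} → ℕ → (Fin k → Family n) → (Fin k → Family n) → Set
ConfigI {n} t F A = Σ (Subset n) (λ T → ∣ T ∣ ≡ t × (∀ i → FamEq (A i) (contain (F i) T)))

ConfigII : {n k : ℕ} → (Fin k → Family n) → (Fin k → Family n) → Set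
ConfigII {n} {k} F A = Σ (Fin k) (λ j → card (F j) ≡ maxFin k (λ i → card (F i))
  × FamEq (A j) (F j) × (∀ i → i ≢ j → FamEq (A i) emptyFam))

{-# OPTIONS --safe #-}
module Submission where

-- Write d = r - t, let L_i be the number of members of F_i containing a fixed t-set, L'_i the same for a
-- (t+1)-set, and let a_i = |A_i|.  Only n >= (d+1) r C(r,t) + r is needed, and C(2r,t+1) >= r C(r,t) shows
-- that it follows from n >= n_S(r,t).  If every A_i has a t-set common to all its members, then a_i <= L_i,
-- and if moreover a t-set common to A_i is missed by some B in A_j, then every member of A_i contains that
-- t-set and a further element of B, so a_i <= r L'_i < L_i.  Otherwise some A_i has no such t-set.  If
-- another A_j is nonempty, a_i <= C(r,t) L_i because members of A_i t-intersect a fixed set, so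
-- (d+1) a_i < |F_i|; and for m ≠ i, branching first over a t-subset T of one member of A_i and then over
-- the elements of a member that does not contain T gives a_m <= r C(r,t) L'_m, so (d+1) a_m <= d L_m.
-- Adding up, the sum of the a_m is smaller than a weighted mean of max |F_m| and the sum of the L_m.

open import Defs
open import Data.Bool using (true; false; _∧_; not; if_then_else_)
import Data.Bool.Properties as Boolₚ
open import Data.Nat hiding (_/_)
open import Data.Nat.Properties
open import Data.Nat.Combinatorics using (_C_; nCk+nC[k+1]≡[n+1]C[k+1]; k>n⇒nCk≡0)
open import Data.Nat.Tactic.RingSolver using (solve-∀)
open import Data.Fin as Fin using (Fin)
import Data.Fin.Properties as Finₚ
open import Data.Fin.Subset using (⊥; ⊤; Subset; inside; outside; _∩_; _∪_; ∣_∣; _⊆_; _∈_; _∉_; ⁅_⁆)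
open import Data.Fin.Subset.Properties
open import Data.Vec using (_∷_; []; here; there)
open import Data.List using (List; []; _∷_; _++_; map; foldr; length; filterᵇ; allFin; applyUpTo)
open import Data.List.Properties using (filter-++; length-++; length-map; map-tabulate; map-cong)
open import Data.List.Relation.Unary.Any using (here; there)
open import Data.List.Membership.Propositional using () renaming (_∈_ to _∈ₗ_)
open import Data.List.Membership.Propositional.Properties using (∈-map⁺; ∈-map⁻; ∈-++⁺ˡ; ∈-++⁺ʳ; ∈-++⁻; ∈-allFin)
open import Data.Nat.ListAction using (sum)
open import Data.Product using (∃; _×_; _,_; proj₁; proj₂)
open import Data.Sum using (_⊎_; inj₁; inj₂; [_,_]′)
open import Function using (_∘_; id; case_of_)
open import Function.Bundles using (_⇔_; mk⇔)
open import Relation.Nullary using (¬_; Dec; yes; no; contradiction)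
open import Relation.Nullary.Decidable using (⌊_⌋; isYes≗does; dec-true; ¬?; _×-dec_; decidable-stable)
open import Relation.Binary.PropositionalEquality hiding (J)

-- Binomial coefficients

C-monoˡ-≤ : ∀ k {m n} → m ≤ n → m C k ≤ n C k
C-monoˡ-≤ zero    _ = ≤-refl
C-monoˡ-≤ (suc k) {n = n} m≤n = go (≤⇒≤′ m≤n)
  where
  go : ∀ {m n} → m ≤′ n → m C suc k ≤ n C suc k
  go ≤′-refl = ≤-refl
  go {n = suc n} (≤′-step m≤n) =
    ≤-trans (go m≤n) (subst (n C suc k ≤_) (nCk+nC[k+1]≡[n+1]C[k+1] n k) (m≤n+m _ _))

-- Among the sets counted on the right are those made of one of the `a` points and `k` of the `b`
-- points.
C-monoˡ-≤-* : ∀ a b k → a * (b C k) ≤ (a + b) C suc k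
C-monoˡ-≤-* zero    b k = z≤n
C-monoˡ-≤-* (suc a) b k = begin
  b C k + a * (b C k)              ≤⟨ +-mono-≤ (C-monoˡ-≤ k (m≤n+m b a)) (C-monoˡ-≤-* a b k) ⟩
  (a + b) C k + (a + b) C suc k    ≡⟨ nCk+nC[k+1]≡[n+1]C[k+1] (a + b) k ⟩
  suc (a + b) C suc k              ∎
  where open ≤-Reasoning

-- The left side counts the sets inside one of two disjoint blocks; as these sets are nonempty, none
-- lies in both.
C-superadditive : ∀ a b k → a C suc k + b C suc k ≤ (a + b) C suc k
C-superadditive zero    b k = ≤-refl
C-superadditive (suc a) b k = begin
  suc a C suc k + b C suc k               ≡⟨ cong (_+ b C suc k) (nCk+nC[k+1]≡[n+1]C[k+1] a k) ⟨
  a C k + a C suc k + b C suc k           ≡⟨ +-assoc (a C k) _ _ ⟩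
  a C k + (a C suc k + b C suc k)         ≤⟨ +-mono-≤ (C-monoˡ-≤ k (m≤m+n a b)) (C-superadditive a b k) ⟩
  (a + b) C k + (a + b) C suc k           ≡⟨ nCk+nC[k+1]≡[n+1]C[k+1] (a + b) k ⟩
  suc (a + b) C suc k                     ∎
  where open ≤-Reasoning

*-C≤C-* : ∀ q a k → q * (a C suc k) ≤ (q * a) C suc k
*-C≤C-* zero    a k = z≤n
*-C≤C-* (suc q) a k = ≤-trans (+-monoʳ-≤ (a C suc k) (*-C≤C-* q a k)) (C-superadditive a (q * a) k)

-- Both sides count the `suc k`-subsets of `suc n` points with one point marked.
C-absorption : ∀ n k → suc k * (suc n C suc k) ≡ suc n * (n C k)
C-absorption zero    zero    = refl
C-absorption zero    (suc k) = begin
  suc (suc k) * (1 C suc (suc k)) ≡⟨ cong (suc (suc k) *_) (k>n⇒nCk≡0 {1} {suc (suc k)} (s≤s (s≤s z≤n))) ⟩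
  suc (suc k) * 0                 ≡⟨ *-zeroʳ (suc (suc k)) ⟩
  0                               ≡⟨ cong (1 *_) (k>n⇒nCk≡0 {0} {suc k} (s≤s z≤n)) ⟨
  1 * (0 C suc k)                 ∎
  where open ≡-Reasoning
C-absorption (suc n) zero    = begin
  1 * (suc (suc n) C 1)     ≡⟨ cong (1 *_) (nCk+nC[k+1]≡[n+1]C[k+1] (suc n) 0) ⟨
  1 * (1 + suc n C 1)       ≡⟨ cong (λ x → 1 * (1 + x)) (trans (sym (*-identityˡ (suc n C 1))) (C-absorption n 0)) ⟩
  1 * (1 + suc n * 1)       ≡⟨ lemma n ⟩
  suc (suc n) * 1           ∎
  where
  open ≡-Reasoning
  lemma : ∀ n → 1 * (1 + suc n * 1) ≡ suc (suc n) * 1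
  lemma = solve-∀
C-absorption (suc n) (suc k) = begin
  suc (suc k) * (suc (suc n) C suc (suc k))
    ≡⟨ cong (suc (suc k) *_) (nCk+nC[k+1]≡[n+1]C[k+1] (suc n) (suc k)) ⟨
  suc (suc k) * (x + y)               ≡⟨ expand k x y ⟩
  x + (suc k * x + suc (suc k) * y)   ≡⟨ cong (x +_) (cong₂ _+_ (C-absorption n k) (C-absorption n (suc k))) ⟩
  x + (suc n * (n C k) + suc n * (n C suc k)) ≡⟨ cong (x +_) (*-distribˡ-+ (suc n) (n C k) _) ⟨
  x + suc n * (n C k + n C suc k)     ≡⟨ cong (λ z → x + suc n * z) (nCk+nC[k+1]≡[n+1]C[k+1] n k) ⟩
  suc (suc n) * x                     ∎
  where
  open ≡-Reasoning
  x = suc n C suc k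
  y = suc n C suc (suc k)
  expand : ∀ k x y → suc (suc k) * (x + y) ≡ x + (suc k * x + suc (suc k) * y)
  expand = solve-∀

-- Both sides count pairs of a `t`-set inside a `(t + j)`-set. The additive form avoids truncated
-- subtraction and lets the induction on `t` apply absorption to each binomial coefficient in which
-- `t` occurs.
C-trinomial : ∀ t m j → ((t + m) C (t + j)) * ((t + j) C t) ≡ ((t + m) C t) * (m C j)
C-trinomial zero    m j = *-comm (m C j) 1
C-trinomial (suc t) m j = *-cancelˡ-≡ _ _ (suc t) (begin
  suc t * (N′ * J′)               ≡⟨ swap₁ (suc t) N′ J′ ⟩
  N′ * (suc t * J′)               ≡⟨ cong (N′ *_) (C-absorption (t + j) t) ⟩
  N′ * (suc (t + j) * J)          ≡⟨ swap₂ N′ (suc (t + j)) J ⟩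
  (suc (t + j) * N′) * J          ≡⟨ cong (_* J) (C-absorption (t + m) (t + j)) ⟩
  (suc (t + m) * N) * J           ≡⟨ *-assoc (suc (t + m)) N J ⟩
  suc (t + m) * (N * J)           ≡⟨ cong (suc (t + m) *_) (C-trinomial t m j) ⟩
  suc (t + m) * (P * (m C j))     ≡⟨ *-assoc (suc (t + m)) P (m C j) ⟨
  (suc (t + m) * P) * (m C j)     ≡⟨ cong (_* (m C j)) (C-absorption (t + m) t) ⟨
  (suc t * P′) * (m C j)          ≡⟨ *-assoc (suc t) P′ (m C j) ⟩
  suc t * (P′ * (m C j))          ∎)
  where
  open ≡-Reasoning
  N′ = suc (t + m) C suc (t + j)
  N  = (t + m) C (t + j)
  J′ = suc (t + j) C suc t
  J  = (t + j) C t
  P′ = suc (t + m) C suc t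
  P  = (t + m) C t
  swap₁ : ∀ a b c → a * (b * c) ≡ b * (a * c)
  swap₁ = solve-∀
  swap₂ : ∀ a b c → a * (b * c) ≡ (b * a) * c
  swap₂ = solve-∀

0<C : ∀ {n k} → k ≤ n → 0 < n C k
0<C {n}     {zero}  _         = s≤s z≤n
0<C {suc n} {suc k} (s≤s k≤n) =
  subst (0 <_) (nCk+nC[k+1]≡[n+1]C[k+1] n k) (≤-trans (0<C k≤n) (m≤m+n (n C k) _))

-- Sums over a set of naturals

-- The recursion shifts `S` and `f` together, which fits the shift of `S` in `layerSize`.
sumBelow : ℕ → NatSet → (ℕ → ℕ) → ℕ
sumBelow zero    S f = 0
sumBelow (suc N) S f = (if S 0 then f 0 else 0) + sumBelow N (S ∘ suc) (f ∘ suc)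

sumOver≡sumBelow : ∀ r S f → sumOver r S f ≡ sumBelow (suc r) S f
sumOver≡sumBelow r S f = go (suc r) id S f (λ _ → refl)
  where
  h : ℕ → ℕ
  h s = if S s then f s else 0
  -- The tail of `applyUpTo e` enumerates by `e ∘ suc`, so the induction carries `e` along.
  go : ∀ N (e : ℕ → ℕ) S′ f′ → (∀ s → h (e s) ≡ (if S′ s then f′ s else 0)) →
       sum (map h (applyUpTo e N)) ≡ sumBelow N S′ f′
  go zero    e S′ f′ eq = refl
  go (suc N) e S′ f′ eq = cong₂ _+_ (eq 0) (go N (e ∘ suc) (S′ ∘ suc) (f′ ∘ suc) (eq ∘ suc))

sumBelow-mono : ∀ N S {f h} → (∀ s → S s ≡ true → f s ≤ h s) → sumBelow N S f ≤ sumBelow N S h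
sumBelow-mono zero    S f≤h = z≤n
sumBelow-mono (suc N) S f≤h with S 0 in eq
... | true  = +-mono-≤ (f≤h 0 eq) (sumBelow-mono N (S ∘ suc) (f≤h ∘ suc))
... | false = sumBelow-mono N (S ∘ suc) (f≤h ∘ suc)

sumBelow-cong : ∀ N S {f h} → (∀ s → S s ≡ true → f s ≡ h s) → sumBelow N S f ≡ sumBelow N S h
sumBelow-cong N S f≡h = ≤-antisym (sumBelow-mono N S (λ s p → ≤-reflexive (f≡h s p)))
                                  (sumBelow-mono N S (λ s p → ≤-reflexive (sym (f≡h s p))))

sumBelow-* : ∀ c N S f → sumBelow N S (λ s → c * f s) ≡ c * sumBelow N S f
sumBelow-* c zero    S f = sym (*-zeroʳ c)
sumBelow-* c (suc N) S f with S 0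
... | true  = trans (cong (c * f 0 +_) (sumBelow-* c N (S ∘ suc) (f ∘ suc)))
                    (sym (*-distribˡ-+ c (f 0) _))
... | false = sumBelow-* c N (S ∘ suc) (f ∘ suc)

sumBelow-+ : ∀ N S f h → sumBelow N S (λ s → f s + h s) ≡ sumBelow N S f + sumBelow N S h
sumBelow-+ zero    S f h = refl
sumBelow-+ (suc N) S f h with S 0
... | true  = trans (cong (f 0 + h 0 +_) (sumBelow-+ N (S ∘ suc) (f ∘ suc) (h ∘ suc)))
                    (interchange (f 0) (h 0) _ _)
  where
  interchange : ∀ a b c d → a + b + (c + d) ≡ a + c + (b + d)
  interchange = solve-∀
... | false = sumBelow-+ N (S ∘ suc) (f ∘ suc) (h ∘ suc)

sumBelow-drop : ∀ t N S f → (∀ s → S s ≡ true → t ≤ s) →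
                sumBelow N S f ≡ sumBelow (N ∸ t) (S ∘ (t +_)) (f ∘ (t +_))
sumBelow-drop zero    N       S f t≤ = refl
sumBelow-drop (suc t) zero    S f t≤ = refl
sumBelow-drop (suc t) (suc N) S f t≤ with S 0 in eq
... | true  = contradiction (t≤ 0 eq) λ ()
... | false = sumBelow-drop t N (S ∘ suc) (f ∘ suc) (λ s p → s≤s⁻¹ (t≤ (suc s) p))

-- The number of X ⊆ [m] with ∣ X ∣ ∈ S, computed by Pascal's recursion.
layerSize : ℕ → NatSet → ℕ
layerSize zero    S = if S 0 then 1 else 0
layerSize (suc m) S = layerSize m S + layerSize m (S ∘ suc)

layerSize-cong : ∀ m {S S′} → S ≗ S′ → layerSize m S ≡ layerSize m S′
layerSize-cong zero    eq = cong (if_then 1 else 0) (eq 0)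
layerSize-cong (suc m) eq = cong₂ _+_ (layerSize-cong m eq) (layerSize-cong m (eq ∘ suc))

layerSize-empty : ∀ m {S} → (∀ s → S s ≢ true) → layerSize m S ≡ 0
layerSize-empty zero    {S} ¬S with S 0 in eq
... | true  = contradiction eq (¬S 0)
... | false = refl
layerSize-empty (suc m) ¬S = cong₂ _+_ (layerSize-empty m ¬S) (layerSize-empty m (¬S ∘ suc))

sumBelow-0C : ∀ N (S : NatSet) → sumBelow N (S ∘ suc) (λ j → 0 C suc j) ≡ 0
sumBelow-0C N S = trans (sumBelow-cong N (S ∘ suc) (λ j _ → k>n⇒nCk≡0 {0} {suc j} (s≤s z≤n)))
                        (sumBelow-* 0 N (S ∘ suc) (λ _ → 0))

-- Sets without and with a fixed point give one sum for `S` and one for `S ∘ suc`; Pascal's rule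
-- merges the two term by term.
layerSize≡sumBelow : ∀ m N S → (∀ s → S s ≡ true → s < N) → layerSize m S ≡ sumBelow N S (m C_)
layerSize≡sumBelow m       zero    S S< = layerSize-empty m (λ s p → contradiction (S< s p) λ ())
layerSize≡sumBelow zero    (suc N) S S< = sym (trans (cong ((if S 0 then 1 else 0) +_) (sumBelow-0C N S)) (+-identityʳ _))
layerSize≡sumBelow (suc m) (suc N) S S< = begin
  layerSize m S + layerSize m (S ∘ suc)
    ≡⟨ cong₂ _+_ (layerSize≡sumBelow m (suc N) S S<)
                 (layerSize≡sumBelow m N (S ∘ suc) (λ s p → s≤s⁻¹ (S< (suc s) p))) ⟩
  (z + sumBelow N (S ∘ suc) (λ j → m C suc j)) + sumBelow N (S ∘ suc) (m C_)
    ≡⟨ rearrange z _ _ ⟩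
  z + (sumBelow N (S ∘ suc) (m C_) + sumBelow N (S ∘ suc) (λ j → m C suc j))
    ≡⟨ cong (z +_) (sumBelow-+ N (S ∘ suc) (m C_) (λ j → m C suc j)) ⟨
  z + sumBelow N (S ∘ suc) (λ j → m C j + m C suc j)
    ≡⟨ cong (z +_) (sumBelow-cong N (S ∘ suc) (λ j _ → nCk+nC[k+1]≡[n+1]C[k+1] m j)) ⟩
  z + sumBelow N (S ∘ suc) (λ j → suc m C suc j) ∎
  where
  open ≡-Reasoning
  z = if S 0 then 1 else 0
  rearrange : ∀ a b c → a + b + c ≡ a + (c + b)
  rearrange = solve-∀

-- Count pairs of a point and a set through it with size in `S`: each of the `suc m` points lies in
-- `layerSize m (S ∘ suc)` sets, and each set has at most `d` points.
layerSize-shift : ∀ m d S → (∀ s → S s ≡ true → s ≤ d) →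
                  suc m * layerSize m (S ∘ suc) ≤ d * layerSize (suc m) S
layerSize-shift m d S S≤ = begin
  suc m * layerSize m (S ∘ suc)
    ≡⟨ cong (suc m *_) (layerSize≡sumBelow m d (S ∘ suc) (λ s → S≤ (suc s))) ⟩
  suc m * sumBelow d (S ∘ suc) (m C_)
    ≡⟨ sumBelow-* (suc m) d (S ∘ suc) (m C_) ⟨
  sumBelow d (S ∘ suc) (λ j → suc m * (m C j))
    ≤⟨ sumBelow-mono d (S ∘ suc) (λ j p → subst (_≤ d * (suc m C suc j)) (C-absorption m j)
         (*-monoˡ-≤ (suc m C suc j) (S≤ (suc j) p))) ⟩
  sumBelow d (S ∘ suc) (λ j → d * (suc m C suc j))
    ≡⟨ sumBelow-* d d (S ∘ suc) (λ j → suc m C suc j) ⟩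
  d * sumBelow d (S ∘ suc) (λ j → suc m C suc j)
    ≤⟨ *-monoʳ-≤ d (m≤n+m _ (if S 0 then 1 else 0)) ⟩
  d * sumBelow (suc d) S (suc m C_)
    ≡⟨ cong (d *_) (layerSize≡sumBelow (suc m) (suc d) S (λ s p → s≤s (S≤ s p))) ⟨
  d * layerSize (suc m) S ∎
  where open ≤-Reasoning

-- Counting families

card-cong : ∀ {n} {A B : Family n} → FamEq A B → card A ≡ card B
card-cong {n} {A} {B} eq = go (allSubsets n)
  where
  go : ∀ Xs → length (filterᵇ A Xs) ≡ length (filterᵇ B Xs)
  go []       = refl
  go (X ∷ Xs) rewrite eq X with B X
  ... | true  = cong suc (go Xs)
  ... | false = go Xs

card-mono : ∀ {n} {A B : Family n} → FamSubset A B → card A ≤ card B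
card-mono {n} {A} {B} A⊆B = go (allSubsets n)
  where
  go : ∀ Xs → length (filterᵇ A Xs) ≤ length (filterᵇ B Xs)
  go []       = z≤n
  go (X ∷ Xs) with A X in a | B X in b
  ... | true  | true  = s≤s (go Xs)
  ... | true  | false = contradiction (trans (sym b) (A⊆B X a)) λ ()
  ... | false | true  = m≤n⇒m≤1+n (go Xs)
  ... | false | false = go Xs

card-split : ∀ {n} (A P : Family n) → card A ≡ card (λ X → A X ∧ P X) + card (λ X → A X ∧ not (P X))
card-split {n} A P = go (allSubsets n)
  where
  go : ∀ Xs → length (filterᵇ A Xs) ≡
              length (filterᵇ (λ X → A X ∧ P X) Xs) + length (filterᵇ (λ X → A X ∧ not (P X)) Xs)
  go []       = refl
  go (X ∷ Xs) with A X | P X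
  ... | true  | true  = cong suc (go Xs)
  ... | true  | false = trans (cong suc (go Xs)) (sym (+-suc _ _))
  ... | false | _     = go Xs

card-∷ : ∀ {n} (A : Family (suc n)) → card A ≡ card (A ∘ (outside ∷_)) + card (A ∘ (inside ∷_))
card-∷ {n} A = begin
  length (filterᵇ A (map (outside ∷_) Xs ++ map (inside ∷_) Xs))
    ≡⟨ cong length (filter-++ _ (map (outside ∷_) Xs) _) ⟩
  length (filterᵇ A (map (outside ∷_) Xs) ++ filterᵇ A (map (inside ∷_) Xs))
    ≡⟨ length-++ (filterᵇ A (map (outside ∷_) Xs)) ⟩
  length (filterᵇ A (map (outside ∷_) Xs)) + length (filterᵇ A (map (inside ∷_) Xs))
    ≡⟨ cong₂ _+_ (go (outside ∷_) Xs) (go (inside ∷_) Xs) ⟩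
  card (A ∘ (outside ∷_)) + card (A ∘ (inside ∷_)) ∎
  where
  open ≡-Reasoning
  Xs = allSubsets n
  go : ∀ (e : Subset n → Subset (suc n)) Ys →
       length (filterᵇ A (map e Ys)) ≡ length (filterᵇ (A ∘ e) Ys)
  go e []       = refl
  go e (Y ∷ Ys) with A (e Y)
  ... | true  = cong suc (go e Ys)
  ... | false = go e Ys

card-empty : ∀ {n} {A : Family n} → (∀ X → A X ≢ true) → card A ≡ 0
card-empty {n} {A} ¬A = go (allSubsets n)
  where
  go : ∀ Xs → length (filterᵇ A Xs) ≡ 0
  go []       = refl
  go (X ∷ Xs) with A X in a
  ... | true  = contradiction a (¬A X)
  ... | false = go Xs

-- The inclusion splits into one for the sets without and one for the sets with the first point; if
-- the totals agree, neither half can fall short.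
card-equality : ∀ {n} {A B : Family n} → FamSubset A B → card B ≤ card A → FamEq A B
card-equality {zero} {A} {B} A⊆B B≤A [] with A [] in a | B [] in b
... | true  | true  = refl
... | true  | false = contradiction (trans (sym b) (A⊆B [] a)) λ ()
... | false | true  = contradiction B≤A λ ()
... | false | false = refl
card-equality {suc n} {A} {B} A⊆B B≤A (s ∷ X)
  with +-squeeze (card-mono (A⊆B ∘ (outside ∷_))) (card-mono (A⊆B ∘ (inside ∷_)))
         (subst₂ _≤_ (card-∷ B) (card-∷ A) B≤A)
  where
  +-squeeze : ∀ {a b c d} → a ≤ c → b ≤ d → c + d ≤ a + b → c ≤ a × d ≤ b
  +-squeeze {a} {b} {c} {d} a≤c b≤d le =
    +-cancelʳ-≤ d c a (≤-trans le (+-monoʳ-≤ a b≤d)) , +-cancelˡ-≤ c d b (≤-trans le (+-monoˡ-≤ b a≤c))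
card-equality A⊆B B≤A (outside ∷ X) | o≤ , _ = card-equality (A⊆B ∘ (outside ∷_)) o≤ X
card-equality A⊆B B≤A (inside ∷ X)  | _ , i≤ = card-equality (A⊆B ∘ (inside ∷_)) i≤ X

-- A union bound. The members in `P y` are split off first, so the remaining ones are covered by the
-- rest of the list and overlaps do no harm.
card-cover : ∀ {n} {Y : Set} (A : Family n) (ys : List Y) (P : Y → Family n) b →
             (∀ y → y ∈ₗ ys → card (P y) ≤ b) →
             (∀ X → A X ≡ true → ∃ λ y → y ∈ₗ ys × P y X ≡ true) →
             card A ≤ length ys * b
card-cover A []       P b P≤ cover =
  ≤-reflexive (card-empty λ X a → case cover X a of λ { (_ , () , _) })
card-cover A (y ∷ ys) P b P≤ cover = begin
  card A                                                   ≡⟨ card-split A (P y) ⟩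
  card (λ X → A X ∧ P y X) + card (λ X → A X ∧ not (P y X)) ≤⟨ +-mono-≤
     (≤-trans (card-mono in-P) (P≤ y (here refl)))
     (card-cover _ ys P b (λ z z∈ → P≤ z (there z∈)) rest) ⟩
  b + length ys * b                                        ∎
  where
  open ≤-Reasoning
  in-P : FamSubset (λ X → A X ∧ P y X) (P y)
  in-P X p with A X
  ... | true = p
  rest : ∀ X → A X ∧ not (P y X) ≡ true → ∃ λ z → z ∈ₗ ys × P z X ≡ true
  rest X p with A X in a | P y X in q
  ... | true | false with cover X a
  ...   | z , here refl , pz = contradiction (trans (sym pz) q) λ ()
  ...   | z , there z∈  , pz = z , z∈ , pz

-- Removing `T` leaves an arbitrary subset of the other points, with its size lowered by `∣ T ∣`. An
-- `outside` head of `T` leaves a free choice, hence a Pascal step; an `inside` head forces the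
-- choice.
card-contain-layers : ∀ {n} (S : NatSet) (T : Subset n) →
                      card (contain (layers n S) T) ≡ layerSize (n ∸ ∣ T ∣) (S ∘ (∣ T ∣ +_))
card-contain-layers S []            with S 0
... | true  = refl
... | false = refl
card-contain-layers {suc n} S (outside ∷ T) = begin
  card (contain (layers (suc n) S) (outside ∷ T))
    ≡⟨ card-∷ (contain (layers (suc n) S) (outside ∷ T)) ⟩
  card (λ X → S ∣ X ∣ ∧ ⌊ (outside ∷ T) ⊆? (outside ∷ X) ⌋)
    + card (λ X → S (suc ∣ X ∣) ∧ ⌊ (outside ∷ T) ⊆? (inside ∷ X) ⌋)
    ≡⟨ cong₂ _+_ (card-cong λ X → cong (S ∣ X ∣ ∧_) (strip outside X))
                 (card-cong λ X → cong (S (suc ∣ X ∣) ∧_) (strip inside X)) ⟩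
  card (contain (layers n S) T) + card (contain (layers n (S ∘ suc)) T)
    ≡⟨ cong₂ _+_ (card-contain-layers S T) (card-contain-layers (S ∘ suc) T) ⟩
  layerSize (n ∸ ∣ T ∣) (S ∘ (∣ T ∣ +_)) + layerSize (n ∸ ∣ T ∣) (S ∘ (suc ∣ T ∣ +_))
    ≡⟨ cong (layerSize (n ∸ ∣ T ∣) (S ∘ (∣ T ∣ +_)) +_) (layerSize-cong (n ∸ ∣ T ∣) λ s → cong S (sym (+-suc ∣ T ∣ s))) ⟩
  layerSize (suc (n ∸ ∣ T ∣)) (S ∘ (∣ T ∣ +_))
    ≡⟨ cong (λ m → layerSize m (S ∘ (∣ T ∣ +_))) (+-∸-assoc 1 (∣p∣≤n T)) ⟨
  layerSize (suc n ∸ ∣ T ∣) (S ∘ (∣ T ∣ +_)) ∎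
  where
  open ≡-Reasoning
  -- The two decisions agree definitionally in `does`, so the proof passes through it.
  strip : ∀ s X → ⌊ (outside ∷ T) ⊆? (s ∷ X) ⌋ ≡ ⌊ T ⊆? X ⌋
  strip s X = trans (isYes≗does ((outside ∷ T) ⊆? (s ∷ X))) (sym (isYes≗does (T ⊆? X)))
card-contain-layers {suc n} S (inside ∷ T) = begin
  card (contain (layers (suc n) S) (inside ∷ T))
    ≡⟨ card-∷ (contain (layers (suc n) S) (inside ∷ T)) ⟩
  card {n} (λ X → S ∣ X ∣ ∧ false) + card (λ X → S (suc ∣ X ∣) ∧ ⌊ (inside ∷ T) ⊆? (inside ∷ X) ⌋)
    ≡⟨ cong₂ _+_ (card-empty {n} {λ X → S ∣ X ∣ ∧ false} λ X p → contradiction (trans (sym p) (Boolₚ.∧-zeroʳ (S ∣ X ∣))) λ ())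
                 (card-cong λ X → cong (S (suc ∣ X ∣) ∧_) (strip X)) ⟩
  card (contain (layers n (S ∘ suc)) T)
    ≡⟨ card-contain-layers (S ∘ suc) T ⟩
  layerSize (n ∸ ∣ T ∣) (S ∘ (suc ∣ T ∣ +_)) ∎
  where
  open ≡-Reasoning
  strip : ∀ X → ⌊ (inside ∷ T) ⊆? (inside ∷ X) ⌋ ≡ ⌊ T ⊆? X ⌋
  strip X = trans (isYes≗does ((inside ∷ T) ⊆? (inside ∷ X))) (sym (isYes≗does (T ⊆? X)))

card-layers : ∀ n S → card (layers n S) ≡ layerSize n S
card-layers zero    S with S 0
... | true  = refl
... | false = refl
card-layers (suc n) S = trans (card-∷ (layers (suc n) S)) (cong₂ _+_ (card-layers n S) (card-layers n (S ∘ suc)))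

-- Intersecting families

⊆-isYes : ∀ {n} {T X : Subset n} → T ⊆ X → ⌊ T ⊆? X ⌋ ≡ true
⊆-isYes {T = T} {X} T⊆X = trans (isYes≗does (T ⊆? X)) (dec-true (T ⊆? X) T⊆X)

isYes-⊆ : ∀ {n} {T X : Subset n} → ⌊ T ⊆? X ⌋ ≡ true → T ⊆ X
isYes-⊆ {T = T} {X} p with T ⊆? X
... | yes T⊆X = T⊆X

contain⁺ : ∀ {n} {F : Family n} {T X} → F X ≡ true → T ⊆ X → contain F T X ≡ true
contain⁺ FX T⊆X = cong₂ _∧_ FX (⊆-isYes T⊆X)

contain⁻ : ∀ {n} {F : Family n} {T X} → contain F T X ≡ true → F X ≡ true × T ⊆ X
contain⁻ {F = F} {T} {X} p with F X
... | true = refl , isYes-⊆ p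

-- Elements, and below also `t`-subsets, are listed because `card-cover` charges by the length of a
-- list.
elements : ∀ {n} → Subset n → List (Fin n)
elements []            = []
elements (outside ∷ p) = map Fin.suc (elements p)
elements (inside  ∷ p) = Fin.zero ∷ map Fin.suc (elements p)

length-elements : ∀ {n} (p : Subset n) → length (elements p) ≡ ∣ p ∣
length-elements []            = refl
length-elements (outside ∷ p) = trans (length-map Fin.suc (elements p)) (length-elements p)
length-elements (inside  ∷ p) = cong suc (trans (length-map Fin.suc (elements p)) (length-elements p))

∈-elements⁺ : ∀ {n} {x : Fin n} {p} → x ∈ p → x ∈ₗ elements p
∈-elements⁺                     here        = here refl
∈-elements⁺ {p = outside ∷ p} (there x∈p) = ∈-map⁺ Fin.suc (∈-elements⁺ x∈p)
∈-elements⁺ {p = inside  ∷ p} (there x∈p) = there (∈-map⁺ Fin.suc (∈-elements⁺ x∈p))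

subsetsOfSize : ∀ {n} → ℕ → Subset n → List (Subset n)
subsetsOfSize zero    p             = ⊥ ∷ []
subsetsOfSize (suc t) []            = []
subsetsOfSize (suc t) (outside ∷ p) = map (outside ∷_) (subsetsOfSize (suc t) p)
subsetsOfSize (suc t) (inside  ∷ p) =
  map (inside ∷_) (subsetsOfSize t p) ++ map (outside ∷_) (subsetsOfSize (suc t) p)

length-subsetsOfSize : ∀ {n} t (p : Subset n) → length (subsetsOfSize t p) ≡ ∣ p ∣ C t
length-subsetsOfSize zero    p             = refl
length-subsetsOfSize (suc t) []            = sym (k>n⇒nCk≡0 {0} {suc t} (s≤s z≤n))
length-subsetsOfSize (suc t) (outside ∷ p) =
  trans (length-map _ (subsetsOfSize (suc t) p)) (length-subsetsOfSize (suc t) p)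
length-subsetsOfSize (suc t) (inside  ∷ p) = begin
  length (map (inside ∷_) (subsetsOfSize t p) ++ map (outside ∷_) (subsetsOfSize (suc t) p))
    ≡⟨ length-++ (map (inside ∷_) (subsetsOfSize t p)) ⟩
  length (map (inside ∷_) (subsetsOfSize t p)) + length (map (outside ∷_) (subsetsOfSize (suc t) p))
    ≡⟨ cong₂ _+_ (trans (length-map _ (subsetsOfSize t p)) (length-subsetsOfSize t p))
                 (trans (length-map _ (subsetsOfSize (suc t) p)) (length-subsetsOfSize (suc t) p)) ⟩
  ∣ p ∣ C t + ∣ p ∣ C suc t
    ≡⟨ nCk+nC[k+1]≡[n+1]C[k+1] ∣ p ∣ t ⟩
  suc ∣ p ∣ C suc t ∎
  where open ≡-Reasoning

∈-subsetsOfSize⁻ : ∀ {n} t (p : Subset n) {T} → T ∈ₗ subsetsOfSize t p → ∣ T ∣ ≡ t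
∈-subsetsOfSize⁻ {n} zero p (here refl) = ∣⊥∣≡0 n
∈-subsetsOfSize⁻ (suc t) (outside ∷ p) T∈ with ∈-map⁻ (outside ∷_) T∈
... | _ , T′∈ , refl = ∈-subsetsOfSize⁻ (suc t) p T′∈
∈-subsetsOfSize⁻ (suc t) (inside ∷ p) T∈ with ∈-++⁻ (map (inside ∷_) (subsetsOfSize t p)) T∈
... | inj₁ T∈ˡ = case ∈-map⁻ (inside ∷_) T∈ˡ of λ { (_ , T′∈ , refl) → cong suc (∈-subsetsOfSize⁻ t p T′∈) }
... | inj₂ T∈ʳ = case ∈-map⁻ (outside ∷_) T∈ʳ of λ { (_ , T′∈ , refl) → ∈-subsetsOfSize⁻ (suc t) p T′∈ }

-- The recursion collects the first `t` points common to `X` and `B`.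
subsetsOfSize-meet : ∀ {n} t (X B : Subset n) → TIntersects t X B →
                     ∃ λ T → T ∈ₗ subsetsOfSize t B × T ⊆ X
subsetsOfSize-meet zero    X             B             _  = ⊥ , here refl , ⊆-min X
subsetsOfSize-meet (suc t) []            []            ()
subsetsOfSize-meet (suc t) (inside ∷ X)  (inside ∷ B)  (s≤s le) with subsetsOfSize-meet t X B le
... | T , T∈ , T⊆X = inside ∷ T , ∈-++⁺ˡ (∈-map⁺ (inside ∷_) T∈) , in⊆in T⊆X
subsetsOfSize-meet (suc t) (outside ∷ X) (inside ∷ B)  le with subsetsOfSize-meet (suc t) X B le
... | T , T∈ , T⊆X = outside ∷ T , ∈-++⁺ʳ (map (inside ∷_) (subsetsOfSize t B)) (∈-map⁺ (outside ∷_) T∈) , out⊆ T⊆X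
subsetsOfSize-meet (suc t) (inside ∷ X)  (outside ∷ B) le with subsetsOfSize-meet (suc t) X B le
... | T , T∈ , T⊆X = outside ∷ T , ∈-map⁺ (outside ∷_) T∈ , out⊆ T⊆X
subsetsOfSize-meet (suc t) (outside ∷ X) (outside ∷ B) le with subsetsOfSize-meet (suc t) X B le
... | T , T∈ , T⊆X = outside ∷ T , ∈-map⁺ (outside ∷_) T∈ , out⊆ T⊆X

∣p∪⁅x⁆∣≡1+∣p∣ : ∀ {n} (p : Subset n) {x} → x ∉ p → ∣ p ∪ ⁅ x ⁆ ∣ ≡ suc ∣ p ∣
∣p∪⁅x⁆∣≡1+∣p∣ (outside ∷ p) {Fin.zero}  _    = cong (suc ∘ ∣_∣) (∪-identityʳ p)
∣p∪⁅x⁆∣≡1+∣p∣ (inside  ∷ p) {Fin.zero}  x∉p = contradiction here x∉p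
∣p∪⁅x⁆∣≡1+∣p∣ (outside ∷ p) {Fin.suc x} x∉p = ∣p∪⁅x⁆∣≡1+∣p∣ p (x∉p ∘ there)
∣p∪⁅x⁆∣≡1+∣p∣ (inside  ∷ p) {Fin.suc x} x∉p = cong suc (∣p∪⁅x⁆∣≡1+∣p∣ p (x∉p ∘ there))

p⊈q⇒∃∉ : ∀ {n} {p q : Subset n} → ¬ (p ⊆ q) → ∃ λ x → x ∈ p × x ∉ q
p⊈q⇒∃∉ {p = p} {q} p⊈q with Finₚ.any? (λ x → (x ∈? p) ×-dec ¬? (x ∈? q))
... | yes e = e
... | no ¬e = contradiction (λ {x} x∈p → decidable-stable (x ∈? q) λ x∉q → ¬e (x , x∈p , x∉q)) p⊈q

-- Were `X ∩ B` inside `T`, it would be a proper subset, since `T` has a point that `B` lacks, and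
-- thus be too small.
meet-outside : ∀ {n} (T X B : Subset n) → T ⊆ X → ¬ (T ⊆ B) → TIntersects ∣ T ∣ X B →
               ∃ λ x → x ∈ X × x ∈ B × x ∉ T
meet-outside T X B T⊆X T⊈B le with (X ∩ B) ⊆? T
... | no ⊈T with p⊈q⇒∃∉ ⊈T
...   | x , x∈ , x∉T = x , proj₁ (x∈p∩q⁻ X B x∈) , proj₂ (x∈p∩q⁻ X B x∈) , x∉T
meet-outside T X B T⊆X T⊈B le | yes ⊆T with p⊈q⇒∃∉ T⊈B
... | x , x∈T , x∉B = contradiction le (<⇒≱ (p⊂q⇒∣p∣<∣q∣ {p = X ∩ B} {T}
        (⊆T , x , x∈T , x∉B ∘ proj₂ ∘ x∈p∩q⁻ X B)))

-- The number of X ⊆ [n] with ∣ X ∣ ∈ S containing a given t-set.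
starSize : ℕ → ℕ → NatSet → ℕ
starSize n t S = layerSize (n ∸ t) (S ∘ (t +_))

card-≤-star : ∀ {n} S {A : Family n} → FamSubset A (layers n S) →
              ∀ T → (∀ X → A X ≡ true → T ⊆ X) → card A ≤ starSize n ∣ T ∣ S
card-≤-star {n} S {A} A⊆S T T⊆ = subst (card A ≤_) (card-contain-layers S T)
  (card-mono λ X a → contain⁺ {F = layers n S} {T} (A⊆S X a) (T⊆ X a))

-- Branching over the elements and the `t`-subsets of a fixed set

module _ {n} (S : NatSet) {A : Family n} (A⊆S : FamSubset A (layers n S)) (r : ℕ) where

  -- By `meet-outside` each member contains `T ∪ ⁅ x ⁆` for some `x` in `B` outside `T`, so at most
  -- `r` stars over sets of size `suc ∣ T ∣` cover the family.
  card-≤-star-avoid : ∀ T B → ∣ B ∣ ≤ r → ¬ (T ⊆ B) → (∀ X → A X ≡ true → T ⊆ X) →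
                      (∀ X → A X ≡ true → TIntersects ∣ T ∣ X B) →
                      card A ≤ r * starSize n (suc ∣ T ∣) S
  card-≤-star-avoid T B B≤r T⊈B T⊆ meets = begin
    card A                                               ≤⟨ card-cover A (elements B) P _ P≤ cover ⟩
    length (elements B) * starSize n (suc ∣ T ∣) S       ≡⟨ cong (_* starSize n (suc ∣ T ∣) S) (length-elements B) ⟩
    ∣ B ∣ * starSize n (suc ∣ T ∣) S                     ≤⟨ *-monoˡ-≤ _ B≤r ⟩
    r * starSize n (suc ∣ T ∣) S                         ∎
    where
    open ≤-Reasoning
    P : Fin n → Family n
    -- For `x` in `T` the set `T ∪ ⁅ x ⁆` is too small to give the bound, so such `x` index the
    -- empty family.
    P x X = not ⌊ x ∈? T ⌋ ∧ contain (layers n S) (T ∪ ⁅ x ⁆) X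
    P≤ : ∀ x → x ∈ₗ elements B → card (P x) ≤ starSize n (suc ∣ T ∣) S
    P≤ x _ with x ∈? T
    ... | yes _  = subst (_≤ starSize n (suc ∣ T ∣) S) (sym (card-empty {n} {λ _ → false} λ _ ())) z≤n
    ... | no x∉T = ≤-reflexive (trans (card-contain-layers S (T ∪ ⁅ x ⁆))
                     (cong (λ u → starSize n u S) (∣p∪⁅x⁆∣≡1+∣p∣ T x∉T)))
    cover : ∀ X → A X ≡ true → ∃ λ x → x ∈ₗ elements B × P x X ≡ true
    cover X a with meet-outside T X B (T⊆ X a) T⊈B (meets X a)
    ... | x , x∈X , x∈B , x∉T = x , ∈-elements⁺ x∈B , PxX
      where
      T∪x⊆X : T ∪ ⁅ x ⁆ ⊆ X
      T∪x⊆X y∈ with x∈p∪q⁻ T ⁅ x ⁆ y∈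
      ... | inj₁ y∈T = T⊆ X a y∈T
      ... | inj₂ y∈x = subst (_∈ X) (sym (x∈⁅y⁆⇒x≡y x y∈x)) x∈X
      PxX : P x X ≡ true
      PxX with x ∈? T
      ... | yes x∈T = contradiction x∈T x∉T
      ... | no _    = contain⁺ {F = layers n S} {T ∪ ⁅ x ⁆} (A⊆S X a) T∪x⊆X

  module _ (t : ℕ) (B : Subset n) (B≤r : ∣ B ∣ ≤ r) (meets : ∀ X → A X ≡ true → TIntersects t X B) where

    card-≤-C-* : ∀ b → (∀ T → ∣ T ∣ ≡ t → card (contain A T) ≤ b) → card A ≤ (r C t) * b
    card-≤-C-* b bound = begin
      card A                             ≤⟨ card-cover A (subsetsOfSize t B) (contain A) b
                                              (λ T T∈ → bound T (∈-subsetsOfSize⁻ t B T∈))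
                                              (λ X a → case subsetsOfSize-meet t X B (meets X a) of
                                                 λ { (T , T∈ , T⊆X) → T , T∈ , contain⁺ {F = A} {T} a T⊆X }) ⟩
      length (subsetsOfSize t B) * b     ≡⟨ cong (_* b) (length-subsetsOfSize t B) ⟩
      (∣ B ∣ C t) * b                    ≤⟨ *-monoˡ-≤ b (C-monoˡ-≤ t B≤r) ⟩
      (r C t) * b                        ∎
      where open ≤-Reasoning

    card-≤-C-*-star : card A ≤ (r C t) * starSize n t S
    card-≤-C-*-star = card-≤-C-* (starSize n t S) λ { T refl →
      card-≤-star S (λ X p → A⊆S X (proj₁ (contain⁻ {F = A} {T} p))) T
        (λ X p → proj₂ (contain⁻ {F = A} {T} p)) }

-- Branch twice: over the `t`-subsets `T` of `B`, then over the elements of a set `B′` that may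
-- depend on `T` and does not contain it. Each branch fixes `suc t` points.
card-≤-nontrivial : ∀ {n} S {A : Family n} → FamSubset A (layers n S) → ∀ r t (B : Subset n) → ∣ B ∣ ≤ r →
  (∀ X → A X ≡ true → TIntersects t X B) →
  (∀ T → ∣ T ∣ ≡ t → ∃ λ B′ → ∣ B′ ∣ ≤ r × ¬ (T ⊆ B′) × (∀ X → A X ≡ true → TIntersects t X B′)) →
  card A ≤ (r C t) * (r * starSize n (suc t) S)
card-≤-nontrivial {n} S {A} A⊆S r t B B≤r meets escape =
  card-≤-C-* S {A} A⊆S r t B B≤r meets _ λ { T refl → case escape T refl of
    λ { (B′ , B′≤r , T⊈B′ , meets′) →
      card-≤-star-avoid S (λ X p → A⊆S X (proj₁ (contain⁻ {F = A} {T} p))) r T B′ B′≤r T⊈B′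
        (λ X p → proj₂ (contain⁻ {F = A} {T} p))
        (λ X p → meets′ X (proj₁ (contain⁻ {F = A} {T} p))) } }

-- Star sizes as sums of binomial coefficients

starSize-sumOver : ∀ n t r S → (∀ s → S s ≡ true → t ≤ s × s ≤ r) →
                   starSize n t S ≡ sumOver r S (λ s → (n ∸ t) C (s ∸ t))
starSize-sumOver n t r S S⊆ = begin
  layerSize (n ∸ t) (S ∘ (t +_))
    ≡⟨ layerSize≡sumBelow (n ∸ t) (suc r ∸ t) (S ∘ (t +_))
         (λ j p → m+n≤o⇒m≤o∸n (suc j) (s≤s (subst (_≤ r) (+-comm t j) (proj₂ (S⊆ (t + j) p))))) ⟩
  sumBelow (suc r ∸ t) (S ∘ (t +_)) ((n ∸ t) C_)
    ≡⟨ sumBelow-cong (suc r ∸ t) (S ∘ (t +_)) (λ j _ → cong ((n ∸ t) C_) (m+n∸m≡n t j)) ⟨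
  sumBelow (suc r ∸ t) (S ∘ (t +_)) (λ j → (n ∸ t) C ((t + j) ∸ t))
    ≡⟨ sumBelow-drop t (suc r) S (λ s → (n ∸ t) C (s ∸ t)) (λ s p → proj₁ (S⊆ s p)) ⟨
  sumBelow (suc r) S (λ s → (n ∸ t) C (s ∸ t))
    ≡⟨ sumOver≡sumBelow r S _ ⟨
  sumOver r S (λ s → (n ∸ t) C (s ∸ t)) ∎
  where open ≡-Reasoning

layerSize>0 : ∀ m S j → j ≤ m → S j ≡ true → 0 < layerSize m S
layerSize>0 zero    S zero    _         p rewrite p = s≤s z≤n
layerSize>0 (suc m) S zero    _         p = ≤-trans (layerSize>0 m S 0 z≤n p) (m≤m+n _ _)
layerSize>0 (suc m) S (suc j) (s≤s j≤m) p = ≤-trans (layerSize>0 m (S ∘ suc) j j≤m p) (m≤n+m _ _)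

-- Sums and maxima over Fin k

sumFin-suc : ∀ k (f : Fin (suc k) → ℕ) → sumFin (suc k) f ≡ f Fin.zero + sumFin k (f ∘ Fin.suc)
sumFin-suc k f = cong (λ xs → f Fin.zero + sum xs)
  (trans (map-tabulate Fin.suc f) (sym (map-tabulate id (f ∘ Fin.suc))))

sumFin-cong : ∀ k {f h : Fin k → ℕ} → f ≗ h → sumFin k f ≡ sumFin k h
sumFin-cong k eq = cong sum (map-cong eq (allFin k))

sumFin-mono : ∀ k {f h : Fin k → ℕ} → (∀ i → f i ≤ h i) → sumFin k f ≤ sumFin k h
sumFin-mono zero    f≤h = z≤n
sumFin-mono (suc k) {f} {h} f≤h = subst₂ _≤_ (sym (sumFin-suc k f)) (sym (sumFin-suc k h))
  (+-mono-≤ (f≤h Fin.zero) (sumFin-mono k (f≤h ∘ Fin.suc)))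

sumFin-mono-< : ∀ k {f h : Fin k → ℕ} → (∀ i → f i ≤ h i) → ∀ i → f i < h i → sumFin k f < sumFin k h
sumFin-mono-< (suc k) {f} {h} f≤h i f<h = subst₂ _<_ (sym (sumFin-suc k f)) (sym (sumFin-suc k h)) (go i f<h)
  where
  go : ∀ i → f i < h i → f Fin.zero + sumFin k (f ∘ Fin.suc) < h Fin.zero + sumFin k (h ∘ Fin.suc)
  go Fin.zero    f<h = +-mono-<-≤ f<h (sumFin-mono k (f≤h ∘ Fin.suc))
  go (Fin.suc i) f<h = +-mono-≤-< (f≤h Fin.zero) (sumFin-mono-< k (f≤h ∘ Fin.suc) i f<h)

sumFin-equality : ∀ k {f h : Fin k → ℕ} → (∀ i → f i ≤ h i) → sumFin k h ≤ sumFin k f → ∀ i → h i ≤ f i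
sumFin-equality k {f} {h} f≤h le i = ≮⇒≥ λ f<h → <⇒≱ (sumFin-mono-< k f≤h i f<h) le

sumFin-* : ∀ c k (f : Fin k → ℕ) → sumFin k (λ i → c * f i) ≡ c * sumFin k f
sumFin-* c zero    f = sym (*-zeroʳ c)
sumFin-* c (suc k) f = begin
  sumFin (suc k) (λ i → c * f i)                             ≡⟨ sumFin-suc k _ ⟩
  c * f Fin.zero + sumFin k (λ i → c * f (Fin.suc i))        ≡⟨ cong (c * f Fin.zero +_) (sumFin-* c k (f ∘ Fin.suc)) ⟩
  c * f Fin.zero + c * sumFin k (f ∘ Fin.suc)                ≡⟨ *-distribˡ-+ c (f Fin.zero) _ ⟨
  c * (f Fin.zero + sumFin k (f ∘ Fin.suc))                  ≡⟨ cong (c *_) (sumFin-suc k f) ⟨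
  c * sumFin (suc k) f ∎
  where open ≡-Reasoning

-- The term `h i` is added on the right at no cost, so that a full sum stands there.
sumFin-except : ∀ k (f h : Fin k → ℕ) i → (∀ j → j ≢ i → f j ≤ h j) → sumFin k f ≤ f i + sumFin k h
sumFin-except (suc k) f h Fin.zero f≤h = begin
  sumFin (suc k) f                                             ≡⟨ sumFin-suc k f ⟩
  f Fin.zero + sumFin k (f ∘ Fin.suc)                          ≤⟨ +-monoʳ-≤ (f Fin.zero) (sumFin-mono k λ j → f≤h (Fin.suc j) λ ()) ⟩
  f Fin.zero + sumFin k (h ∘ Fin.suc)                          ≤⟨ +-monoʳ-≤ (f Fin.zero) (m≤n+m _ (h Fin.zero)) ⟩
  f Fin.zero + (h Fin.zero + sumFin k (h ∘ Fin.suc))           ≡⟨ cong (f Fin.zero +_) (sumFin-suc k h) ⟨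
  f Fin.zero + sumFin (suc k) h ∎
  where open ≤-Reasoning
sumFin-except (suc k) f h (Fin.suc i) f≤h = begin
  sumFin (suc k) f                                             ≡⟨ sumFin-suc k f ⟩
  f Fin.zero + sumFin k (f ∘ Fin.suc)                          ≤⟨ +-mono-≤ (f≤h Fin.zero λ ())
     (sumFin-except k (f ∘ Fin.suc) (h ∘ Fin.suc) i λ j j≢i → f≤h (Fin.suc j) (j≢i ∘ Finₚ.suc-injective)) ⟩
  h Fin.zero + (f (Fin.suc i) + sumFin k (h ∘ Fin.suc))        ≡⟨ swap (h Fin.zero) (f (Fin.suc i)) _ ⟩
  f (Fin.suc i) + (h Fin.zero + sumFin k (h ∘ Fin.suc))        ≡⟨ cong (f (Fin.suc i) +_) (sumFin-suc k h) ⟨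
  f (Fin.suc i) + sumFin (suc k) h ∎
  where
  open ≤-Reasoning
  swap : ∀ a b c → a + (b + c) ≡ b + (a + c)
  swap = solve-∀

f≤sumFin : ∀ k (f : Fin k → ℕ) i → f i ≤ sumFin k f
f≤sumFin (suc k) f Fin.zero    = subst (f Fin.zero ≤_) (sym (sumFin-suc k f)) (m≤m+n _ _)
f≤sumFin (suc k) f (Fin.suc i) = subst (f (Fin.suc i) ≤_) (sym (sumFin-suc k f))
  (≤-trans (f≤sumFin k (f ∘ Fin.suc) i) (m≤n+m _ _))

sumFin-single : ∀ k (f : Fin k → ℕ) i → (∀ j → j ≢ i → f j ≡ 0) → sumFin k f ≡ f i
sumFin-single k f i f≡0 = ≤-antisym
  (≤-trans (sumFin-except k f (λ _ → 0) i (λ j j≢i → ≤-reflexive (f≡0 j j≢i)))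
           (≤-reflexive (trans (cong (f i +_) (sumFin-* 0 k (λ _ → 0))) (+-identityʳ (f i)))))
  (f≤sumFin k f i)

maxFin-cong : ∀ k {f h : Fin k → ℕ} → f ≗ h → maxFin k f ≡ maxFin k h
maxFin-cong k eq = cong (foldr _⊔_ 0) (map-cong eq (allFin k))

f≤maxFin : ∀ k (f : Fin k → ℕ) i → f i ≤ maxFin k f
f≤maxFin k f i = go (∈-allFin i)
  where
  go : ∀ {is} → i ∈ₗ is → f i ≤ foldr _⊔_ 0 (map f is)
  go (here refl) = m≤m⊔n _ _
  go (there i∈)  = ≤-trans (go i∈) (m≤n⊔m _ _)

-- The bounds on n

-- Halve a set of `2 * r` points: one point of the first half and `t` of the second make
-- `r * (r C t)` different `(t + 1)`-sets.
nS-bound : ∀ r t → suc (r ∸ t) * (r * (r C t)) + r ≤ nS r t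
nS-bound r t = +-monoˡ-≤ r (*-mono-≤ (≤-reflexive (+-comm 1 (r ∸ t))) (begin
  r * (r C t)              ≤⟨ C-monoˡ-≤-* r r t ⟩
  (r + r) C suc t          ≡⟨ cong₂ _C_ (cong (r +_) (sym (+-identityʳ r))) (+-comm 1 t) ⟩
  (2 * r) C (t + 1)        ≤⟨ C-monoˡ-≤ (t + 1) (m≤m⊔n (2 * r) _) ⟩
  mRT r t C (t + 1)        ∎))
  where open ≤-Reasoning

module LargeGround (t r n : ℕ) (1≤t : 1 ≤ t) (t≤r : t ≤ r) (n-large : suc (r ∸ t) * (r * (r C t)) + r ≤ n) where

  open ≤-Reasoning

  d : ℕ
  d = r ∸ t

  r≤n : r ≤ n
  r≤n = ≤-trans (m≤n+m r _) n-large

  n∸t-large : suc d * (r * (r C t)) ≤ n ∸ t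
  -- The summand `r` in the bound on `n` pays for the subtraction of `t`.
  n∸t-large = m+n≤o⇒m≤o∸n _ (≤-trans (+-monoʳ-≤ _ t≤r) n-large)

  0<rCt : 0 < r C t
  0<rCt = 0<C t≤r

  t<n : t < n
  -- The lower bound on `n ∸ t` is a product of positive factors.
  t<n = m∸n≢0⇒n<m λ eq → contradiction (≤-trans (*-mono-≤ {1} {suc d} (s≤s z≤n) (*-mono-≤ (≤-trans 1≤t t≤r) 0<rCt)) n∸t-large)
          (subst (λ x → ¬ (1 ≤ x)) (sym eq) λ ())

  module _ (S : NatSet) (S⊆ : SubsetOfRange t r S) (S≢∅ : NonEmptyNatSet S) where

    starSize>0 : 0 < starSize n t S
    starSize>0 = let s , p = S≢∅ ; t≤s , s≤r = S⊆ s p in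
      layerSize>0 (n ∸ t) (S ∘ (t +_)) (s ∸ t) (∸-monoˡ-≤ t (≤-trans s≤r r≤n))
        (trans (cong S (m+[n∸m]≡n t≤s)) p)

    -- Members of a star have at most `d` points beyond the `t` fixed ones, so fixing one more point
    -- costs a factor of at least `(n ∸ t) / d`; the size of `n` makes this outweigh the branching
    -- factor `r * (r C t)`.
    starSize-suc-≤ : suc d * ((r C t) * (r * starSize n (suc t) S)) ≤ d * starSize n t S
    starSize-suc-≤ = begin
      suc d * ((r C t) * (r * starSize n (suc t) S))     ≡⟨ rearrange (suc d) (r C t) r (starSize n (suc t) S) ⟩
      suc d * (r * (r C t)) * starSize n (suc t) S       ≤⟨ *-monoˡ-≤ (starSize n (suc t) S) n∸t-large ⟩
      (n ∸ t) * starSize n (suc t) S                     ≡⟨ cong₂ _*_ n∸t (layerSize-cong (n ∸ suc t) λ j → cong S (sym (+-suc t j))) ⟩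
      suc (n ∸ suc t) * layerSize (n ∸ suc t) ((S ∘ (t +_)) ∘ suc)
        ≤⟨ layerSize-shift (n ∸ suc t) d (S ∘ (t +_))
             (λ j p → m+n≤o⇒m≤o∸n j (subst (_≤ r) (+-comm t j) (proj₂ (S⊆ (t + j) p)))) ⟩
      d * layerSize (suc (n ∸ suc t)) (S ∘ (t +_))       ≡⟨ cong (λ m → d * layerSize m (S ∘ (t +_))) n∸t ⟨
      d * starSize n t S                                 ∎
      where
      n∸t : n ∸ t ≡ suc (n ∸ suc t)
      n∸t = +-∸-assoc 1 t<n
      rearrange : ∀ a b c e → a * (b * (c * e)) ≡ a * (c * b) * e
      rearrange = solve-∀

    -- [n] contains q disjoint blocks of size r, hence q * (r C t) ≤ n C t.
    q = suc (suc d * (r C t))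

    q*rCt≤nCt : q * (r C t) ≤ n C t
    q*rCt≤nCt = begin
      -- `t` is written as a successor because disjoint blocks share the empty set, which would be
      -- counted repeatedly.
      q * (r C t)      ≡⟨ cong (λ u → q * (r C u)) t≡ ⟩
      q * (r C suc (t ∸ 1)) ≤⟨ *-C≤C-* q r (t ∸ 1) ⟩
      -- The choice of `q` makes `q * r` equal to the assumed lower bound on `n`.
      (q * r) C suc (t ∸ 1) ≤⟨ C-monoˡ-≤ (suc (t ∸ 1)) (subst (_≤ n) (rearrange (suc d) r (r C t)) n-large) ⟩
      n C suc (t ∸ 1)  ≡⟨ cong (n C_) t≡ ⟨
      n C t            ∎
      where
      t≡ : t ≡ suc (t ∸ 1)
      t≡ = sym (m+[n∸m]≡n 1≤t)
      rearrange : ∀ a b c → a * (b * c) + b ≡ (1 + a * c) * b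
      rearrange = solve-∀

    -- By the trinomial identity the ratio of the two binomial coefficients is `n C t` over
    -- `(t + j) C t`, and this denominator is at most `r C t`.
    q*C≤C : ∀ j → t + j ≤ r → q * ((n ∸ t) C j) ≤ n C (t + j)
    q*C≤C j t+j≤r = *-cancelʳ-≤ _ _ ((t + j) C t) ⦃ >-nonZero (0<C (m≤m+n t j)) ⦄ (begin
      q * ((n ∸ t) C j) * ((t + j) C t)          ≤⟨ *-monoʳ-≤ (q * ((n ∸ t) C j)) (C-monoˡ-≤ t t+j≤r) ⟩
      q * ((n ∸ t) C j) * (r C t)                ≡⟨ rearrange q ((n ∸ t) C j) (r C t) ⟩
      q * (r C t) * ((n ∸ t) C j)                ≤⟨ *-monoˡ-≤ ((n ∸ t) C j) q*rCt≤nCt ⟩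
      (n C t) * ((n ∸ t) C j)                    ≡⟨ cong (λ m → (m C t) * ((n ∸ t) C j)) n≡ ⟨
      ((t + (n ∸ t)) C t) * ((n ∸ t) C j)        ≡⟨ C-trinomial t (n ∸ t) j ⟨
      ((t + (n ∸ t)) C (t + j)) * ((t + j) C t)  ≡⟨ cong (λ m → (m C (t + j)) * ((t + j) C t)) n≡ ⟩
      (n C (t + j)) * ((t + j) C t)              ∎)
      where
      n≡ : t + (n ∸ t) ≡ n
      n≡ = m+[n∸m]≡n (<⇒≤ t<n)
      rearrange : ∀ a b c → a * b * c ≡ a * c * b
      rearrange = solve-∀

    *-starSize<layerSize : suc d * ((r C t) * starSize n t S) < layerSize n S
    *-starSize<layerSize = begin-strict
      suc d * ((r C t) * starSize n t S)      ≡⟨ *-assoc (suc d) (r C t) _ ⟨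
      -- The `1` inside `q` adds one more star, which is nonempty; this makes the inequality strict.
      suc d * (r C t) * starSize n t S        <⟨ m<n+m _ starSize>0 ⟩
      q * starSize n t S
        ≡⟨ cong (q *_) (layerSize≡sumBelow (n ∸ t) (suc r ∸ t) (S ∘ (t +_)) below) ⟩
      q * sumBelow (suc r ∸ t) (S ∘ (t +_)) ((n ∸ t) C_)
        ≡⟨ sumBelow-* q (suc r ∸ t) (S ∘ (t +_)) ((n ∸ t) C_) ⟨
      sumBelow (suc r ∸ t) (S ∘ (t +_)) (λ j → q * ((n ∸ t) C j))
        ≤⟨ sumBelow-mono (suc r ∸ t) (S ∘ (t +_)) (λ j p → q*C≤C j (proj₂ (S⊆ (t + j) p))) ⟩
      sumBelow (suc r ∸ t) (S ∘ (t +_)) (λ j → n C (t + j))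
        ≡⟨ sumBelow-drop t (suc r) S (n C_) (λ s p → proj₁ (S⊆ s p)) ⟨
      sumBelow (suc r) S (n C_)
        ≡⟨ layerSize≡sumBelow n (suc r) S (λ s p → s≤s (proj₂ (S⊆ s p))) ⟨
      layerSize n S ∎
      where
      below : ∀ j → S (t + j) ≡ true → j < suc r ∸ t
      below j p = m+n≤o⇒m≤o∸n (suc j) (s≤s (subst (_≤ r) (+-comm t j) (proj₂ (S⊆ (t + j) p))))

-- The case analysis for cross-`t`-intersecting families

module CrossIntersecting
  (t r n k : ℕ) (1≤t : 1 ≤ t) (t≤r : t ≤ r) (n-large : suc (r ∸ t) * (r * (r C t)) + r ≤ n)
  (S : Fin k → NatSet) (S⊆ : ∀ i → SubsetOfRange t r (S i)) (S≢∅ : ∀ i → NonEmptyNatSet (S i))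
  (A : Fin k → Family n) (cross : CrossTIntersecting t A) (A⊆ : ∀ i → FamSubset (A i) (layers n (S i)))
  where

  open LargeGround t r n 1≤t t≤r n-large

  total stars largest : ℕ
  total   = sumFin k λ i → card (A i)
  stars   = sumFin k λ i → starSize n t (S i)
  largest = maxFin k λ i → layerSize n (S i)

  -- Each nonstrict case keeps its bound together with the structure forced when that bound is
  -- attained, so one case analysis serves both the inequality and its equality cases.
  data Outcome : Set where
    strict : total < stars ⊔ largest → Outcome
    star   : total ≤ stars → (stars ≤ total → ConfigI t (λ i → layers n (S i)) A) → Outcome
    single : total ≤ largest → (largest ≤ total → ConfigII (λ i → layers n (S i)) A) → Outcome

  size≤r : ∀ i X → A i X ≡ true → ∣ X ∣ ≤ r
  size≤r i X a = proj₂ (S⊆ i ∣ X ∣ (A⊆ i X a))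

  ContainedInAll : Fin k → Subset n → Set
  ContainedInAll i T = ∀ X → A i X ≡ true → T ⊆ X

  Avoided : Fin k → Subset n → Set
  Avoided i T = ∃ λ X → A i X ≡ true × ¬ (T ⊆ X)

  avoided? : ∀ i T → Dec (Avoided i T)
  avoided? i T = anySubset? λ X → (A i X Boolₚ.≟ true) ×-dec ¬? (T ⊆? X)

  ¬avoided⇒contained : ∀ {i T} → ¬ Avoided i T → ContainedInAll i T
  ¬avoided⇒contained {T = T} ¬av X a = decidable-stable (T ⊆? X) λ T⊈X → ¬av (X , a , T⊈X)

  -- `Nontrivial` negates `Trivial` in a positive form: it supplies, for each `t`-set, a member to
  -- branch over. An empty family counts as trivial.
  Trivial Nontrivial : Fin k → Set
  Trivial i    = ∃ λ T → ∣ T ∣ ≡ t × ContainedInAll i T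
  Nontrivial i = ∀ T → ∣ T ∣ ≡ t → Avoided i T

  trivial⊎nontrivial : ∀ i → Trivial i ⊎ Nontrivial i
  trivial⊎nontrivial i with anySubset? (λ T → (∣ T ∣ ≟ t) ×-dec ¬? (avoided? i T))
  ... | yes (T , T≡t , ¬av) = inj₁ (T , T≡t , ¬avoided⇒contained ¬av)
  ... | no ¬triv            = inj₂ λ T T≡t → decidable-stable (avoided? i T) λ ¬av → ¬triv (T , T≡t , ¬av)

  nontrivial⇒nonempty : ∀ {i} → Nontrivial i → ∃ λ X → A i X ≡ true
  nontrivial⇒nonempty nt =
    -- The full set meets itself in `n` points, which yields some `t`-subset to be avoided.
    let T , T∈ , _ = subsetsOfSize-meet {n} t ⊤ ⊤
          (≤-trans (<⇒≤ t<n) (≤-reflexive (sym (trans (cong ∣_∣ (∩-idem {n} ⊤)) (∣⊤∣≡n n)))))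
        X , a , _ = nt T (∈-subsetsOfSize⁻ t ⊤ T∈)
    in X , a

  trivial⇒≤star : ∀ {i} → Trivial i → card (A i) ≤ starSize n t (S i)
  trivial⇒≤star {i} (T , T≡t , T⊆) =
    subst (λ u → card (A i) ≤ starSize n u (S i)) T≡t (card-≤-star (S i) (A⊆ i) T T⊆)

  layers≤largest : ∀ i → layerSize n (S i) ≤ largest
  layers≤largest = f≤maxFin k (λ i → layerSize n (S i))

  onlyOneNonempty : ∀ i → (∀ j → j ≢ i → ∀ X → A j X ≢ true) → Outcome
  onlyOneNonempty i empty = single (≤-trans total≤ (layers≤largest i)) config
    where
    total≡ : total ≡ card (A i)
    total≡ = sumFin-single k (λ j → card (A j)) i λ j j≢i → card-empty (empty j j≢i)
    total≤ : total ≤ layerSize n (S i)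
    total≤ = subst₂ _≤_ (sym total≡) (card-layers n (S i)) (card-mono (A⊆ i))
    config : largest ≤ total → ConfigII (λ i → layers n (S i)) A
    -- Now `card (A i)`, the size of its layers and `largest` coincide.
    config largest≤ = i
      , trans (card-layers n (S i)) (trans (≤-antisym (layers≤largest i) (≤-trans largest≤ total≤))
          (maxFin-cong k λ j → sym (card-layers n (S j))))
      , card-equality (A⊆ i) (subst₂ _≤_ (sym (card-layers n (S i))) total≡ (≤-trans (layers≤largest i) largest≤))
      , λ j j≢i X → Boolₚ.¬-not (empty j j≢i X)

  -- In units of `1 / suc d`, family `i` costs less than its own layers and every other family at
  -- most `d` times its star. The total thus lies below a mean of `largest` and `stars` with weights
  -- `1` and `d`.
  nontrivialOutcome : ∀ i → Nontrivial i → ∀ j → j ≢ i → ∀ B → A j B ≡ true → Outcome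
  nontrivialOutcome i nt j j≢i B b = strict (*-cancelˡ-< (suc d) total (stars ⊔ largest) (begin-strict
    suc d * total
      ≡⟨ sumFin-* (suc d) k (λ m → card (A m)) ⟨
    sumFin k (λ m → suc d * card (A m))
      ≤⟨ sumFin-except k (λ m → suc d * card (A m)) (λ m → d * starSize n t (S m)) i small ⟩
    suc d * card (A i) + sumFin k (λ m → d * starSize n t (S m))
      ≡⟨ cong (suc d * card (A i) +_) (sumFin-* d k (λ m → starSize n t (S m))) ⟩
    suc d * card (A i) + d * stars
      ≤⟨ +-monoˡ-≤ (d * stars) (*-monoʳ-≤ (suc d) (card-≤-C-*-star (S i) (A⊆ i) r t B (size≤r j B b)
           λ X a → cross i j (j≢i ∘ sym) X B a b)) ⟩
    suc d * ((r C t) * starSize n t (S i)) + d * stars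
      <⟨ +-monoˡ-< (d * stars) (*-starSize<layerSize (S i) (S⊆ i) (S≢∅ i)) ⟩
    layerSize n (S i) + d * stars
      ≤⟨ +-mono-≤ (≤-trans (layers≤largest i) (m≤n⊔m stars largest)) (*-monoʳ-≤ d (m≤m⊔n stars largest)) ⟩
    suc d * (stars ⊔ largest) ∎))
    where
    open ≤-Reasoning
    small : ∀ m → m ≢ i → suc d * card (A m) ≤ d * starSize n t (S m)
    small m m≢i =
      -- `X₀` is the member of `A i` whose `t`-subsets start the branching; `Y` below is the member
      -- that avoids the chosen one.
      let X₀ , a₀ = nontrivial⇒nonempty nt in
      ≤-trans (*-monoʳ-≤ (suc d) (card-≤-nontrivial (S m) (A⊆ m) r t X₀ (size≤r i X₀ a₀)
          (λ X a → cross m i m≢i X X₀ a a₀)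
          (λ T T≡t → let Y , y , T⊈Y = nt T T≡t in Y , size≤r i Y y , T⊈Y , λ X a → cross m i m≢i X Y a y)))
        (starSize-suc-≤ (S m) (S⊆ m) (S≢∅ m))

  -- `T` is common to `A i`. If no family avoids it, all lie in their stars over this one `T`.
  -- Otherwise `A i` falls strictly below its star size, while each other family is still bounded by
  -- its own.
  trivialOutcome : Fin k → (∀ i → Trivial i) → Outcome
  trivialOutcome i triv with triv i
  ... | T , T≡t , T⊆ with Finₚ.any? (λ j → avoided? j T)
  -- Equality of the sums forces equality in each family.
  ...   | no ¬av = star (sumFin-mono k (trivial⇒≤star ∘ triv)) λ stars≤ → T , T≡t , λ j →
            card-equality (contained j) (subst (_≤ card (A j)) (sym (card-star j))
              (sumFin-equality k (trivial⇒≤star ∘ triv) stars≤ j))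
    where
    contained : ∀ j → FamSubset (A j) (contain (layers n (S j)) T)
    contained j X a = contain⁺ {F = layers n (S j)} {T} (A⊆ j X a) (¬avoided⇒contained (λ av → ¬av (j , av)) X a)
    card-star : ∀ j → card (contain (layers n (S j)) T) ≡ starSize n t (S j)
    card-star j = trans (card-contain-layers (S j) T) (cong (λ u → starSize n u (S j)) T≡t)
  ...   | yes (j , B , b , T⊈B) = strict (≤-trans
            (sumFin-mono-< k (trivial⇒≤star ∘ triv) i (*-cancelˡ-< (suc d) _ _ (begin-strict
              suc d * card (A i)
                ≤⟨ *-monoʳ-≤ (suc d) (subst (λ u → card (A i) ≤ r * starSize n (suc u) (S i)) T≡t
                     (card-≤-star-avoid (S i) (A⊆ i) r T B (size≤r j B b) T⊈B T⊆
                       λ X a → subst (λ u → TIntersects u X B) (sym T≡t) (cross i j i≢j X B a b))) ⟩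
              -- The positive factor `r C t` is inserted to reach the form of `starSize-suc-≤`.
              suc d * (r * starSize n (suc t) (S i))
                ≤⟨ *-monoʳ-≤ (suc d) (m≤n*m _ (r C t) ⦃ >-nonZero 0<rCt ⦄) ⟩
              suc d * ((r C t) * (r * starSize n (suc t) (S i)))
                ≤⟨ starSize-suc-≤ (S i) (S⊆ i) (S≢∅ i) ⟩
              d * starSize n t (S i)
                <⟨ m<n+m _ (starSize>0 (S i) (S⊆ i) (S≢∅ i)) ⟩
              suc d * starSize n t (S i) ∎)))
            (m≤m⊔n stars largest))
    where
    open ≤-Reasoning
    i≢j : i ≢ j
    i≢j refl = T⊈B (T⊆ B b)

  -- The given index selects the family from which the trivial case takes its `T`.
  outcome : Fin k → Outcome
  outcome i₀ with Finₚ.any? (λ i → nontrivial? i)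
    where
    nontrivial? : ∀ i → Dec (Nontrivial i)
    nontrivial? i with trivial⊎nontrivial i
    ... | inj₁ (T , T≡t , T⊆) = no λ nt → let X , a , T⊈X = nt T T≡t in T⊈X (T⊆ X a)
    ... | inj₂ nt             = yes nt
  ... | no ¬nt = trivialOutcome i₀ λ i → [ id , (λ nt → contradiction (i , nt) ¬nt) ]′ (trivial⊎nontrivial i)
  ... | yes (i , nt) with Finₚ.any? (λ j → ¬? (j Finₚ.≟ i) ×-dec anySubset? (λ X → A j X Boolₚ.≟ true))
  ...   | yes (j , j≢i , B , b) = nontrivialOutcome i nt j j≢i B b
  ...   | no ¬other             = onlyOneNonempty i λ j j≢i X a → ¬other (j , j≢i , X , a)

  configI⇒total : ConfigI t (λ i → layers n (S i)) A → total ≡ stars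
  configI⇒total (T , T≡t , A≗) = sumFin-cong k λ i → trans (card-cong (A≗ i))
    (trans (card-contain-layers (S i) T) (cong (λ u → starSize n u (S i)) T≡t))

  configII⇒total : ConfigII (λ i → layers n (S i)) A → total ≡ largest
  configII⇒total (j , max , A≗ , empty) = trans
    (sumFin-single k (λ i → card (A i)) j λ i i≢j → card-empty λ X a → contradiction (trans (sym a) (empty i i≢j X)) λ ())
    (trans (card-cong A≗) (trans max (maxFin-cong k λ i → card-layers n (S i))))

-- The bound and its equality cases

theorem2p10 : (t r n k : ℕ) → 1 ≤ t → t ≤ r → n ≥ nS r t → k ≥ 2 →
    (S : Fin k → NatSet) →
    (∀ i → SubsetOfRange t r (S i)) → (∀ i → NonEmptyNatSet (S i)) →
    (A : Fin k → Family n) →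
    CrossTIntersecting t A →
    (∀ i → FamSubset (A i) (layers n (S i))) →
    (sumFin k (λ i → card (A i))
    ≤ sumFin k (λ i → sumOver r (S i) (λ s → (n ∸ t) C (s ∸ t)))
    ⊔ maxFin k (λ i → sumOver r (S i) (λ s → n C s)))
    ×
    ((sumFin k (λ i → card (A i))
    ≡ sumFin k (λ i → sumOver r (S i) (λ s → (n ∸ t) C (s ∸ t)))
    ⊔ maxFin k (λ i → sumOver r (S i) (λ s → n C s)))
    ⇔
    ((maxFin k (λ i → sumOver r (S i) (λ s → n C s))
    < sumFin k (λ i → sumOver r (S i) (λ s → (n ∸ t) C (s ∸ t)))
    × ConfigI t (λ i → layers n (S i)) A)
    ⊎ (sumFin k (λ i → sumOver r (S i) (λ s → (n ∸ t) C (s ∸ t)))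
    < maxFin k (λ i → sumOver r (S i) (λ s → n C s))
    × ConfigII (λ i → layers n (S i)) A)
    ⊎ (sumFin k (λ i → sumOver r (S i) (λ s → (n ∸ t) C (s ∸ t)))
    ≡ maxFin k (λ i → sumOver r (S i) (λ s → n C s))
    × (ConfigI t (λ i → layers n (S i)) A ⊎ ConfigII (λ i → layers n (S i)) A))))
theorem2p10 t r n k@(suc _) 1≤t t≤r n≥ _ S S⊆ S≢∅ A cross A⊆ =
  subst₂ Conclusion stars≡ largest≡ (conclusion (outcome Fin.zero))
  where
  open CrossIntersecting t r n k 1≤t t≤r (≤-trans (nS-bound r t) n≥) S S⊆ S≢∅ A cross A⊆

  I II : Set
  I  = ConfigI t (λ i → layers n (S i)) A
  II = ConfigII (λ i → layers n (S i)) A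

  -- Abstracting both sides of the maximum lets a single `subst₂` pass from star and layer sizes to
  -- sums of binomial coefficients.
  Conclusion : ℕ → ℕ → Set
  Conclusion x y = (total ≤ x ⊔ y) × ((total ≡ x ⊔ y) ⇔ ((y < x × I) ⊎ (x < y × II) ⊎ (x ≡ y × (I ⊎ II))))

  stars≡ : stars ≡ sumFin k (λ i → sumOver r (S i) (λ s → (n ∸ t) C (s ∸ t)))
  stars≡ = sumFin-cong k λ i → starSize-sumOver n t r (S i) (S⊆ i)

  -- A layer is the star of the empty set.
  largest≡ : largest ≡ maxFin k (λ i → sumOver r (S i) (λ s → n C s))
  largest≡ = maxFin-cong k λ i → starSize-sumOver n 0 r (S i) λ s p → z≤n , proj₂ (S⊆ i s p)

  bound : Outcome → total ≤ stars ⊔ largest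
  bound (strict <max) = <⇒≤ <max
  bound (star ≤stars _) = ≤-trans ≤stars (m≤m⊔n stars largest)
  bound (single ≤largest _) = ≤-trans ≤largest (m≤n⊔m stars largest)

  extremal : Outcome → total ≡ stars ⊔ largest → I ⊎ II
  extremal (strict <max)      eq = contradiction eq (<⇒≢ <max)
  extremal (star _ config)    eq = inj₁ (config (subst (stars ≤_) (sym eq) (m≤m⊔n stars largest)))
  extremal (single _ config)  eq = inj₂ (config (subst (largest ≤_) (sym eq) (m≤n⊔m stars largest)))

  -- A configuration pins `total` to its own side of the maximum, so that side cannot be the smaller
  -- one.
  classify : total ≡ stars ⊔ largest → I ⊎ II →
             (largest < stars × I) ⊎ (stars < largest × II) ⊎ (stars ≡ largest × (I ⊎ II))
  classify eq (inj₁ c) with m≤n⇒m<n∨m≡n (m⊔n≤o⇒n≤o stars largest (≤-reflexive (trans (sym eq) (configI⇒total c))))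
  ... | inj₁ largest<stars = inj₁ (largest<stars , c)
  ... | inj₂ largest≡stars = inj₂ (inj₂ (sym largest≡stars , inj₁ c))
  classify eq (inj₂ c) with m≤n⇒m<n∨m≡n (m⊔n≤o⇒m≤o stars largest (≤-reflexive (trans (sym eq) (configII⇒total c))))
  ... | inj₁ stars<largest = inj₂ (inj₁ (stars<largest , c))
  ... | inj₂ stars≡largest = inj₂ (inj₂ (stars≡largest , inj₂ c))

  attained : (largest < stars × I) ⊎ (stars < largest × II) ⊎ (stars ≡ largest × (I ⊎ II)) → total ≡ stars ⊔ largest
  attained (inj₁ (l<s , c))               = trans (configI⇒total c) (sym (m≥n⇒m⊔n≡m (<⇒≤ l<s)))
  attained (inj₂ (inj₁ (s<l , c)))        = trans (configII⇒total c) (sym (m≤n⇒m⊔n≡n (<⇒≤ s<l)))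
  attained (inj₂ (inj₂ (s≡l , inj₁ c)))   = trans (configI⇒total c) (sym (m≥n⇒m⊔n≡m (≤-reflexive (sym s≡l))))
  attained (inj₂ (inj₂ (s≡l , inj₂ c)))   = trans (configII⇒total c) (sym (m≤n⇒m⊔n≡n (≤-reflexive s≡l)))

  conclusion : Outcome → Conclusion stars largest
  conclusion o = bound o , mk⇔ (λ eq → classify eq (extremal o eq)) attained
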